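{- Let $\widehat{L}=(\widehat{l}_{ij})\in\mathbb{R}^{n\times n}$ be the Laplacian matrix of a simple undirected graph with $n$ nodes ordered by the RCM (Reverse Cuthill-McKee) algorithm. For $i\in\{1,\dots,n\}$ let $s_i(\widehat{L})=\sum_{j=1}^{i}\widehat{l}_{ij}$ be the sum of the $i$-th row of $\widehat{L}$ up to the diagonal. Then $\widehat{L}$ is irreducible if and only if $s_i(\widehat{L})=0$ only occurs for $i=n$.
   Context: Graphs are finite, undirected, without loops or multiple edges. For a graph with $n$ nodes numbered $1,\dots,n$ and adjacency matrix $A=(a_{ij})$, the (unnormalized) Laplacian matrix is $L=D-A$, where $D=\mathrm{diag}(d_1,\dots,d_n)$ and $d_i=\sum_{j}a_{ij}$ is the degree of node $i$. RCM ordering: build a list $u_1,u_2,\dots,u_n$ of all nodes as follows. Select a starting node (e.g. one of lowest degree) and let it be $u_1$. For $i=1,2,\dots$ in turn, append to the end of the list the neighbors of $u_i$ that are not yet in the list, in increasing order of degree. If all listed nodes have been processed in this way but some nodes are not yet listed, select a new starting node among the unlisted ones, append it to the list, and continue. Finally reverse the order: node $u_j$ receives the new number $n+1-j$. If $P$ is the corresponding permutation matrix ($p_{ij}=1$ iff the node with new number $i$ has original number $j$), the Laplacian of the graph ordered by RCM is $\widehat{L}=PLP^T$. A matrix $M\in\mathbb{R}^{n\times n}$ with $n\ge 2$ is reducible if there are a permutation matrix $Q$ and an integer $1\le r\le n-1$ such that $Q^TMQ=\begin{bmatrix} B & C\\ 0 & E\end{bmatrix}$ with $B\in\mathbb{R}^{r\times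 r}$ and $0$ the $(n-r)\times r$ zero block; a $1\times 1$ matrix is reducible if it is $0$. A matrix is irreducible if it is not reducible.
   Formalization: The formal theorem assumes n ≥ 2; for n = 1 the statement fails, since the Laplacian is the 1×1 zero matrix, which is reducible by definition, while s_1 = 0 occurs only for i = 1 = n. -}

module Defs where

open import Data.Bool.Base using (Bool; true; false; if_then_else_)
open import Data.Fin.Base using (Fin; zero; toℕ; inject≤; opposite)
open import Data.Fin.Permutation using (Permutation′; _⟨$⟩ʳ_)
open import Data.Fin.Properties using (_≟_; toℕ<n)
open import Data.Integer.Base as ℤ using (ℤ; 0ℤ; 1ℤ)
open import Data.Integer.Properties using (+-*-semiring)
open import Data.List.Base using (List; []; _∷_; _++_; [_]; map; tabulate)
open import Data.List.Membership.Propositional using (_∈_; _∉_)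
open import Data.List.Relation.Unary.Linked using (Linked)
open import Data.List.Relation.Unary.Unique.Propositional using (Unique)
open import Data.Nat.Base using (ℕ; _≤_; _<_)
open import Data.Product.Base using (_×_; ∃-syntax)
open import Function.Bundles using (_⇔_)
open import Relation.Binary.PropositionalEquality using (_≡_)
open import Relation.Nullary using (¬_; does)

open import Algebra.Properties.Semiring.Sum +-*-semiring using (sum)

private
  variable
    n : ℕ

-- Every matrix below has integer entries (Laplacians and permutation matrices),
-- and reducibility only asks which entries vanish, so ℤ stands in for ℝ.
Matrix : ℕ → Set
Matrix n = Fin n → Fin n → ℤ

infixl 7 _⊗_
infix 8 _ᵀ

_⊗_ : Matrix n → Matrix n → Matrix n
(M ⊗ N) i j = sum (λ k → M i k ℤ.* N k j)

_ᵀ : Matrix n → Matrix n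
(M ᵀ) i j = M j i

-- p i j = 1 iff π sends j to i.
permutationMatrix : Permutation′ n → Matrix n
permutationMatrix π i j = if does (π ⟨$⟩ʳ j ≟ i) then 1ℤ else 0ℤ

-- In `block`, r is the size of the leading block B; 1 ≤ r < n forces n ≥ 2, and
-- the equation says that the lower-left (n - r) × r block of Qᵀ M Q is zero.
-- B, C and E are then the remaining blocks, with no condition on them.
data Reducible : Matrix n → Set where
  single : {M : Matrix 1} → M zero zero ≡ 0ℤ → Reducible M
  block  : {M : Matrix n} (π : Permutation′ n) (r : ℕ) → 1 ≤ r → r < n →
           (let Q = permutationMatrix π) →
           (∀ i j → r ≤ toℕ i → toℕ j < r → (Q ᵀ ⊗ M ⊗ Q) i j ≡ 0ℤ) →
           Reducible M

Irreducible : Matrix n → Set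
Irreducible M = ¬ Reducible M

-- Indices are 0-based, so the row up to and including the diagonal consists of
-- its first suc (toℕ i) entries.
rowSumToDiagonal : Matrix n → Fin n → ℤ
rowSumToDiagonal M i = sum (λ j → M i (inject≤ j (toℕ<n i)))

record Graph (n : ℕ) : Set where
  field
    adjacent : Fin n → Fin n → Bool
    symmetric : ∀ v w → adjacent v w ≡ adjacent w v
    loopless : ∀ v → adjacent v v ≡ false

module _ (G : Graph n) where
  open Graph G

  adjacencyMatrix : Matrix n
  adjacencyMatrix i j = if adjacent i j then 1ℤ else 0ℤ

  degree : Fin n → ℤ
  degree i = sum (λ j → adjacencyMatrix i j)

  degreeMatrix : Matrix n
  degreeMatrix i j = if does (i ≟ j) then degree i else 0ℤ

  laplacian : Matrix n
  laplacian i j = degreeMatrix i j ℤ.- adjacencyMatrix i j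

  -- `CM done queue`: the procedure can reach a state in which the list built so
  -- far is done ++ queue and exactly the nodes of done have been processed.
  -- Starting nodes, and the order among neighbours of equal degree, are arbitrary.
  data CM : List (Fin n) → List (Fin n) → Set where
    empty : CM [] []
    start : ∀ {done} v → CM done [] → v ∉ done → CM done [ v ]
    visit : ∀ {done u queue} (vs : List (Fin n)) → CM done (u ∷ queue) →
            Unique vs →
            (∀ w → w ∈ vs ⇔ (adjacent u w ≡ true × w ∉ done ++ u ∷ queue)) →
            Linked (λ v w → degree v ℤ.≤ degree w) vs →
            CM (done ++ [ u ]) (queue ++ vs)

  -- π maps original numbers to new numbers. The equation says that the list has
  -- length n and that its j-th node gets the new number n + 1 - j (1-based);
  -- since π is injective, the list therefore contains each node exactly once.
  IsRCM : Permutation′ n → Set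
  IsRCM π = ∃[ us ] (CM us [] × map (π ⟨$⟩ʳ_) us ≡ tabulate opposite)

  -- The Laplacian of the graph with node j renumbered as π j.
  reorderedLaplacian : Permutation′ n → Matrix n
  reorderedLaplacian π = P ⊗ laplacian ⊗ P ᵀ
    where P = permutationMatrix π

{-# OPTIONS --safe #-}
-- Row i of a Laplacian sums to zero and is nonpositive off the diagonal, so s_i = 0
-- exactly when node i has no neighbour with a higher number.
--
-- A reducing permutation splits the nodes into two nonempty classes without edges
-- between them. If every node but the last has a higher-numbered neighbour, climbing
-- along such neighbours reaches the last node from every class, a contradiction.
--
-- Conversely, a node in the Cuthill-McKee list either has a neighbour listed before it
-- or was chosen as a starting node, in which case the nodes listed before it are closed
-- under adjacency. After the reversal, s_i = 0 therefore forces the nodes numbered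
-- above i to be closed under adjacency, so L̂ itself has a zero block below row i.
module Submission where

open import Defs
open import Algebra.Bundles using (AbelianGroup)
import Algebra.Properties.Group
import Algebra.Properties.Semiring.Sum
open import Data.Bool.Base using (Bool; true; false; if_then_else_)
open import Data.Bool.Properties as Bool using (¬-not)
open import Data.Fin.Base as Fin using (Fin; zero; suc; toℕ; fromℕ<; inject≤; opposite)
open import Data.Fin.Induction using (>-wellFounded)
open import Data.Fin.Permutation
  using (Permutation′; _⟨$⟩ʳ_; _⟨$⟩ˡ_; inverseˡ; inverseʳ; flip; id)
open import Data.Fin.Properties
  using (_≟_; toℕ<n; toℕ-injective; toℕ-fromℕ; toℕ-fromℕ<; punchInᵢ≢i;
    opposite-prop; opposite-involutive)
open import Data.Integer.Base as ℤ using (ℤ; 0ℤ; 1ℤ; -≤+)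
open import Data.Integer.Properties as ℤ using (+-*-semiring)
open import Data.List.Base using (List; []; _∷_; _++_; [_]; map; tabulate)
open import Data.List.Membership.Propositional using (_∈_)
import Data.List.Membership.DecPropositional as DecMembership
open import Data.List.Membership.Propositional.Properties
  using (∈-++⁺ˡ; ∈-++⁺ʳ; ∈-++⁻; ∈-∃++; ∈-insert; ∈-map⁻; ∈-tabulate⁺)
open import Data.List.Properties using (++-assoc; ++-identityʳ; ∷-injective)
import Data.List.Relation.Unary.All as All
open import Data.List.Relation.Unary.AllPairs using (AllPairs; _∷_)
import Data.List.Relation.Unary.AllPairs.Properties as AllPairs
open import Data.List.Relation.Unary.Any using (here; there)
open import Data.Nat.Base using (ℕ; zero; suc; _≤_; _<_; z≤n; s≤s; s≤s⁻¹)
import Data.Nat.Properties as ℕ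
open import Data.Product.Base using (_×_; _,_; proj₁; ∃-syntax)
open import Data.Sum.Base using (_⊎_; inj₁; inj₂)
open import Function.Base using (_∘_)
open import Function.Bundles using (_⇔_; mk⇔; Equivalence)
open import Induction.WellFounded using (Acc; acc)
open import Relation.Binary.PropositionalEquality
  using (_≡_; _≢_; refl; sym; trans; cong; cong₂; subst; subst₂; module ≡-Reasoning)
open import Relation.Nullary using (¬_; yes; no; does; contradiction)
open import Relation.Nullary.Decidable using (decidable-stable; dec-true; dec-false)

private
  module +-Group = Algebra.Properties.Group (AbelianGroup.group ℤ.+-0-abelianGroup)
  module Σ = Algebra.Properties.Semiring.Sum +-*-semiring

  variable
    m n : ℕ

open Σ using (sum)

-- Sums of integers

sum-zero : (f : Fin n → ℤ) → (∀ k → f k ≡ 0ℤ) → sum f ≡ 0ℤ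
sum-zero {n} f f≡0 = trans (Σ.sum-cong-≗ f≡0) (Σ.sum-replicate-zero n)

sum-supported : (f : Fin n → ℤ) (i : Fin n) → (∀ k → k ≢ i → f k ≡ 0ℤ) → sum f ≡ f i
sum-supported {suc n} f i f≡0 = begin
  sum f                             ≡⟨ Σ.sum-remove {i = i} f ⟩
  f i ℤ.+ sum (f ∘ Fin.punchIn i)   ≡⟨ cong (λ z → f i ℤ.+ z) (sum-zero _ λ k → f≡0 _ (punchInᵢ≢i i k)) ⟩
  f i ℤ.+ 0ℤ                        ≡⟨ ℤ.+-identityʳ (f i) ⟩
  f i                               ∎
  where open ≡-Reasoning

sum-nonPositive : (f : Fin n → ℤ) → (∀ k → f k ℤ.≤ 0ℤ) → sum f ℤ.≤ 0ℤ
sum-nonPositive {zero}  f f≤0 = ℤ.≤-refl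
sum-nonPositive {suc n} f f≤0 = ℤ.+-mono-≤ (f≤0 zero) (sum-nonPositive (f ∘ suc) (f≤0 ∘ suc))

+-nonPositive-zero : ∀ {x y} → x ℤ.≤ 0ℤ → y ℤ.≤ 0ℤ → x ℤ.+ y ≡ 0ℤ → x ≡ 0ℤ × y ≡ 0ℤ
+-nonPositive-zero {x} {y} x≤0 y≤0 x+y≡0 =
  ℤ.≤-antisym x≤0 (begin
    0ℤ        ≡⟨ x+y≡0 ⟨
    x ℤ.+ y   ≤⟨ ℤ.+-monoʳ-≤ x y≤0 ⟩
    x ℤ.+ 0ℤ  ≡⟨ ℤ.+-identityʳ x ⟩
    x         ∎) ,
  ℤ.≤-antisym y≤0 (begin
    0ℤ        ≡⟨ x+y≡0 ⟨
    x ℤ.+ y   ≤⟨ ℤ.+-monoˡ-≤ y x≤0 ⟩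
    0ℤ ℤ.+ y  ≡⟨ ℤ.+-identityˡ y ⟩
    y         ∎)
  where open ℤ.≤-Reasoning

sum-inject≤ : .(m≤n : m ≤ n) (f : Fin n → ℤ) → (∀ j → m ≤ toℕ j → f j ≡ 0ℤ) →
              sum (λ j → f (inject≤ j m≤n)) ≡ sum f
sum-inject≤ {zero}           m≤n f f≡0 = sym (sum-zero f λ j → f≡0 j z≤n)
sum-inject≤ {suc m} {suc n}  m≤n f f≡0 =
  cong (λ z → f zero ℤ.+ z) (sum-inject≤ (s≤s⁻¹ m≤n) (f ∘ suc) λ j m≤j → f≡0 (suc j) (s≤s m≤j))

-- Cancelling the common first `m` terms leaves a zero sum of nonpositive terms, so each of them
-- vanishes.
sum-inject≤⁻ : .(m≤n : m ≤ n) (f : Fin n → ℤ) → (∀ j → m ≤ toℕ j → f j ℤ.≤ 0ℤ) →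
               sum f ≡ sum (λ j → f (inject≤ j m≤n)) → ∀ j → m ≤ toℕ j → f j ≡ 0ℤ
-- At `m = 0` the truncated sum is empty, so `eq` says that `f` itself sums to zero.
sum-inject≤⁻ {zero} {suc n} m≤n f f≤0 eq j m≤j
  with f0≡0 , rest ← +-nonPositive-zero (f≤0 zero z≤n)
                       (sum-nonPositive (f ∘ suc) λ k → f≤0 (suc k) z≤n) eq
  with j
... | zero  = f0≡0
... | suc k = sum-inject≤⁻ z≤n (f ∘ suc) (λ k _ → f≤0 (suc k) z≤n) rest k z≤n
sum-inject≤⁻ {suc m} {suc n} m≤n f f≤0 eq (suc j) (s≤s m≤j) =
  sum-inject≤⁻ (s≤s⁻¹ m≤n) (f ∘ suc) (λ k m≤k → f≤0 (suc k) (s≤s m≤k))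
    (+-Group.∙-cancelˡ (f zero) _ _ eq) j m≤j

-- Permutation matrices

permutationMatrix-1 : (π : Permutation′ n) {i j : Fin n} →
                      π ⟨$⟩ʳ j ≡ i → permutationMatrix π i j ≡ 1ℤ
permutationMatrix-1 π {i} {j} eq = cong (if_then 1ℤ else 0ℤ) (dec-true (π ⟨$⟩ʳ j ≟ i) eq)

permutationMatrix-0 : (π : Permutation′ n) {i j : Fin n} →
                      π ⟨$⟩ʳ j ≢ i → permutationMatrix π i j ≡ 0ℤ
permutationMatrix-0 π {i} {j} ne = cong (if_then 1ℤ else 0ℤ) (dec-false (π ⟨$⟩ʳ j ≟ i) ne)

⊗-unitRow : (M N : Matrix n) (i j k : Fin n) →
            M i k ≡ 1ℤ → (∀ l → l ≢ k → M i l ≡ 0ℤ) → (M ⊗ N) i j ≡ N k j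
⊗-unitRow M N i j k one zeros = begin
  (M ⊗ N) i j       ≡⟨ sum-supported _ k (λ l l≢k → cong (ℤ._* N l j) (zeros l l≢k)) ⟩
  M i k ℤ.* N k j   ≡⟨ cong (ℤ._* N k j) one ⟩
  1ℤ ℤ.* N k j      ≡⟨ ℤ.*-identityˡ (N k j) ⟩
  N k j             ∎
  where open ≡-Reasoning

⊗-unitColumn : (M N : Matrix n) (i j k : Fin n) →
               N k j ≡ 1ℤ → (∀ l → l ≢ k → N l j ≡ 0ℤ) → (M ⊗ N) i j ≡ M i k
⊗-unitColumn M N i j k one zeros =
  -- Transposing reverses the order of the factors and turns the unit column into a unit row.
  trans (Σ.sum-cong-≗ λ l → ℤ.*-comm (M i l) (N l j)) (⊗-unitRow (N ᵀ) (M ᵀ) j i k one zeros)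

-- Row `i` of the permutation matrix has its 1 in column `π ⟨$⟩ˡ i`, hence the inverse in both
-- indices.
permute-from : (π : Permutation′ n) (M : Matrix n) (i j : Fin n) →
               (permutationMatrix π ⊗ M ⊗ permutationMatrix π ᵀ) i j ≡ M (π ⟨$⟩ˡ i) (π ⟨$⟩ˡ j)
permute-from π M i j = trans
  (⊗-unitColumn (P ⊗ M) (P ᵀ) i j (π ⟨$⟩ˡ j) one zeros)
  (⊗-unitRow P M i (π ⟨$⟩ˡ j) (π ⟨$⟩ˡ i) one zeros)
  where
  P = permutationMatrix π
  one : ∀ {k} → P k (π ⟨$⟩ˡ k) ≡ 1ℤ
  one = permutationMatrix-1 π (inverseʳ π)
  zeros : ∀ {k} l → l ≢ π ⟨$⟩ˡ k → P k l ≡ 0ℤ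
  zeros l l≢ = permutationMatrix-0 π λ eq → l≢ (trans (sym (inverseˡ π)) (cong (π ⟨$⟩ˡ_) eq))

-- With the transpose on the left, columns matter instead of rows: column `i` has its 1 in row
-- `π ⟨$⟩ʳ i`.
permute-to : (π : Permutation′ n) (M : Matrix n) (i j : Fin n) →
             (permutationMatrix π ᵀ ⊗ M ⊗ permutationMatrix π) i j ≡ M (π ⟨$⟩ʳ i) (π ⟨$⟩ʳ j)
permute-to π M i j = trans
  (⊗-unitColumn (Q ᵀ ⊗ M) Q i j (π ⟨$⟩ʳ j) one zeros)
  (⊗-unitRow (Q ᵀ) M i (π ⟨$⟩ʳ j) (π ⟨$⟩ʳ i) one zeros)
  where
  Q = permutationMatrix π
  one : ∀ {k} → Q (π ⟨$⟩ʳ k) k ≡ 1ℤ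
  one = permutationMatrix-1 π refl
  zeros : ∀ {k} l → l ≢ π ⟨$⟩ʳ k → Q l k ≡ 0ℤ
  zeros l l≢ = permutationMatrix-0 π (l≢ ∘ sym)

-- Matrices are functions known to agree only entrywise, so reducibility is carried over entry by
-- entry.
Reducible-resp : {M N : Matrix n} → (∀ i j → M i j ≡ N i j) → Reducible M → Reducible N
Reducible-resp M≗N (single M≡0) = single (trans (sym (M≗N zero zero)) M≡0)
Reducible-resp {M = M} {N} M≗N (block π r 1≤r r<n B≡0) = block π r 1≤r r<n λ i j r≤i j<r → begin
  (permutationMatrix π ᵀ ⊗ N ⊗ permutationMatrix π) i j  ≡⟨ permute-to π N i j ⟩
  N (π ⟨$⟩ʳ i) (π ⟨$⟩ʳ j)                                ≡⟨ M≗N _ _ ⟨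
  M (π ⟨$⟩ʳ i) (π ⟨$⟩ʳ j)                                ≡⟨ permute-to π M i j ⟨
  (permutationMatrix π ᵀ ⊗ M ⊗ permutationMatrix π) i j  ≡⟨ B≡0 i j r≤i j<r ⟩
  0ℤ                                                     ∎
  where open ≡-Reasoning

-- Laplacians

module _ (G : Graph n) where
  open Graph G

  degreeMatrix-diagonal : ∀ i → degreeMatrix G i i ≡ degree G i
  degreeMatrix-diagonal i = cong (if_then degree G i else 0ℤ) (dec-true (i ≟ i) refl)

  degreeMatrix-offDiagonal : ∀ {i j} → i ≢ j → degreeMatrix G i j ≡ 0ℤ
  degreeMatrix-offDiagonal {i} {j} i≢j =
    cong (if_then degree G i else 0ℤ) (dec-false (i ≟ j) i≢j)

  laplacian-offDiagonal : ∀ {i j} → i ≢ j → laplacian G i j ≡ ℤ.- adjacencyMatrix G i j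
  laplacian-offDiagonal {i} {j} i≢j = trans
    (cong (ℤ._- adjacencyMatrix G i j) (degreeMatrix-offDiagonal i≢j)) (ℤ.+-identityˡ _)

  laplacian-nonPositive : ∀ {i j} → i ≢ j → laplacian G i j ℤ.≤ 0ℤ
  laplacian-nonPositive {i} {j} i≢j rewrite laplacian-offDiagonal i≢j with adjacent i j
  ... | true  = -≤+
  ... | false = ℤ.≤-refl

  laplacian-zero⇔ : ∀ {i j} → i ≢ j → laplacian G i j ≡ 0ℤ ⇔ adjacent i j ≡ false
  laplacian-zero⇔ {i} {j} i≢j rewrite laplacian-offDiagonal i≢j with adjacent i j
  ... | true  = mk⇔ (λ ()) (λ ())
  ... | false = mk⇔ (λ _ → refl) (λ _ → refl)

  -- Adding the adjacency row back leaves the row of the degree matrix, whose only possibly nonzero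
  -- entry is the degree.
  laplacian-rowSum : ∀ i → sum (laplacian G i) ≡ 0ℤ
  laplacian-rowSum i = +-Group.∙-cancelʳ (degree G i) _ _ (begin
    sum (laplacian G i) ℤ.+ sum (adjacencyMatrix G i)
      ≡⟨ Σ.∑-distrib-+ (laplacian G i) (adjacencyMatrix G i) ⟨
    sum (λ j → laplacian G i j ℤ.+ adjacencyMatrix G i j)
      ≡⟨ Σ.sum-cong-≗ (λ j → +-Group.//-rightDividesˡ (adjacencyMatrix G i j) (degreeMatrix G i j)) ⟩
    sum (degreeMatrix G i)
      ≡⟨ sum-supported _ i (λ j j≢i → degreeMatrix-offDiagonal (j≢i ∘ sym)) ⟩
    degreeMatrix G i i
      ≡⟨ degreeMatrix-diagonal i ⟩
    degree G i
      ≡⟨ ℤ.+-identityˡ _ ⟨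
    0ℤ ℤ.+ degree G i ∎)
    where open ≡-Reasoning

  -- The whole row sums to zero, so the part up to the diagonal vanishes exactly when the
  -- nonpositive entries beyond it all do.
  rowSumToDiagonal-zero⇔ : ∀ i → rowSumToDiagonal (laplacian G) i ≡ 0ℤ ⇔
                           (∀ j → i Fin.< j → adjacent i j ≡ false)
  rowSumToDiagonal-zero⇔ i = mk⇔
    (λ s≡0 j i<j → to (laplacian-zero⇔ (<⇒≢ i<j))
      (sum-inject≤⁻ (toℕ<n i) (laplacian G i) (λ k i<k → laplacian-nonPositive (<⇒≢ i<k))
        (trans (laplacian-rowSum i) (sym s≡0)) j i<j))
    (λ none → trans
      (sum-inject≤ (toℕ<n i) (laplacian G i) λ j i<j → from (laplacian-zero⇔ (<⇒≢ i<j)) (none j i<j))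
      (laplacian-rowSum i))
    where
    open Equivalence
    <⇒≢ : ∀ {j} → i Fin.< j → i ≢ j
    <⇒≢ i<j = ℕ.<⇒≢ i<j ∘ cong toℕ

  -- Well-founded induction from the highest number downwards; `c` is a two-colouring that is
  -- constant along edges.
  climb-to-last : (c : Fin n → Bool) →
    (∀ {v w} → adjacent v w ≡ true → c v ≡ c w) →
    (∀ i → (∀ j → i Fin.< j → adjacent i j ≡ false) → suc (toℕ i) ≡ n) →
    ∀ {l} → suc (toℕ l) ≡ n → ∀ i → c i ≡ c l
  climb-to-last c mono climb {l} l-last i = go i (>-wellFounded i)
    where
    go : ∀ i → Acc Fin._>_ i → c i ≡ c l
    -- No higher neighbour is ever exhibited: if the colours differed, a higher neighbour would
    -- contradict the induction hypothesis, so `i` would have none and be the last node `l` itself.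
    go i (acc rec) = decidable-stable (c i Bool.≟ c l) λ ci≢cl →
      ci≢cl (cong c (toℕ-injective (ℕ.suc-injective (trans
        (climb i λ j i<j → ¬-not λ i~j → ci≢cl (trans (mono i~j) (go j (rec i<j))))
        (sym l-last)))))

  laplacian-reducible : 2 ≤ n → Reducible (laplacian G) →
    ¬ (∀ i → (∀ j → i Fin.< j → adjacent i j ≡ false) → suc (toℕ i) ≡ n)
  -- The Laplacian of a single node is zero and so reducible, although its only index is the last;
  -- `2 ≤ n` excludes this.
  laplacian-reducible (s≤s ()) (single _)
  laplacian-reducible (s≤s {n = m} _) (block σ r 1≤r r<n B≡0) climb =
    contradiction (trans (sym inside) (trans (monochromatic _ _) outside)) λ ()
    where
    position : Fin n → ℕ
    position v = toℕ (σ ⟨$⟩ˡ v)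

    c : Fin n → Bool
    c v = does (position v ℕ.<? r)

    noEdge : ∀ {v w} → r ≤ position v → position w < r → adjacent v w ≡ false
    noEdge {v} {w} r≤v w<r = Equivalence.to (laplacian-zero⇔ v≢w) (begin
      laplacian G v w
        ≡⟨ cong₂ (laplacian G) (inverseʳ σ) (inverseʳ σ) ⟨
      laplacian G (σ ⟨$⟩ʳ (σ ⟨$⟩ˡ v)) (σ ⟨$⟩ʳ (σ ⟨$⟩ˡ w))
        ≡⟨ permute-to σ (laplacian G) (σ ⟨$⟩ˡ v) (σ ⟨$⟩ˡ w) ⟨
      (permutationMatrix σ ᵀ ⊗ laplacian G ⊗ permutationMatrix σ) (σ ⟨$⟩ˡ v) (σ ⟨$⟩ˡ w)
        ≡⟨ B≡0 _ _ r≤v w<r ⟩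
      0ℤ ∎)
      where
      open ≡-Reasoning
      v≢w : v ≢ w
      v≢w refl = ℕ.<⇒≱ w<r r≤v

    sameClass : ∀ {v w} → adjacent v w ≡ true → c v ≡ c w
    sameClass {v} {w} v~w with position v ℕ.<? r | position w ℕ.<? r
    ... | yes v<r | yes w<r = trans (dec-true (_ ℕ.<? r) v<r) (sym (dec-true (_ ℕ.<? r) w<r))
    ... | no v≮r  | no w≮r  = trans (dec-false (_ ℕ.<? r) v≮r) (sym (dec-false (_ ℕ.<? r) w≮r))
    ... | no v≮r  | yes w<r = contradiction (trans (sym v~w) (noEdge (ℕ.≮⇒≥ v≮r) w<r)) λ ()
    -- The zero block has rows outside and columns inside the leading class; symmetry of the graph
    -- covers this opposite direction.
    ... | yes v<r | no w≮r  = contradiction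
      (trans (sym v~w) (trans (symmetric v w) (noEdge (ℕ.≮⇒≥ w≮r) v<r))) λ ()

    monochromatic : ∀ v w → c v ≡ c w
    monochromatic v w = trans (toLast v) (sym (toLast w))
      where toLast = climb-to-last c sameClass climb {Fin.fromℕ m} (cong suc (toℕ-fromℕ m))

    positionOf : ∀ {k} (k<n : k < n) → position (σ ⟨$⟩ʳ fromℕ< k<n) ≡ k
    positionOf k<n = trans (cong toℕ (inverseˡ σ)) (toℕ-fromℕ< k<n)

    -- Neither class is empty: position `0` is in the leading block since `1 ≤ r`, and position `r`
    -- exists outside it since `r < n`.
    inside : c (σ ⟨$⟩ʳ fromℕ< (ℕ.<-trans 1≤r r<n)) ≡ true
    inside = dec-true (_ ℕ.<? r) (subst (_< r) (sym (positionOf (ℕ.<-trans 1≤r r<n))) 1≤r)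

    outside : c (σ ⟨$⟩ʳ fromℕ< r<n) ≡ false
    outside = dec-false (_ ℕ.<? r) (ℕ.≤⇒≯ (ℕ.≤-reflexive (sym (positionOf r<n))))

  -- The identity permutation works: the leading block takes the 0-based indices up to and including
  -- `i`, and no edge leads from a later index into it.
  laplacian-block : ∀ i → suc (toℕ i) ≢ n →
    (∀ {j k} → i Fin.< j → adjacent j k ≡ true → i Fin.< k) → Reducible (laplacian G)
  laplacian-block i i≢last upClosed =
    block id (suc (toℕ i)) (s≤s z≤n) (ℕ.≤∧≢⇒< (toℕ<n i) i≢last) λ j k i<j k≤i →
      trans (permute-to id (laplacian G) j k)
        (Equivalence.from (laplacian-zero⇔ λ { refl → ℕ.<⇒≱ k≤i i<j })
          (¬-not λ j~k → ℕ.<⇒≱ k≤i (upClosed i<j j~k)))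

-- Cuthill-McKee lists

splitAt-++ : ∀ {A : Set} (as : List A) {bs} xs {v ys} → as ++ bs ≡ xs ++ v ∷ ys →
             (∃[ cs ] as ≡ xs ++ v ∷ cs) ⊎ (∃[ cs ] xs ≡ as ++ cs × bs ≡ cs ++ v ∷ ys)
splitAt-++ []       xs       refl = inj₂ (xs , refl , refl)
splitAt-++ (a ∷ as) []       refl = inj₁ (as , refl)
splitAt-++ (a ∷ as) (x ∷ xs) eq with refl , eq′ ← ∷-injective eq with splitAt-++ as xs eq′
... | inj₁ (cs , refl)        = inj₁ (cs , refl)
... | inj₂ (cs , refl , bs≡) = inj₂ (cs , refl , bs≡)

-- A visit moves the boundary between `done` and the queue past `u`; the list as a whole only grows
-- at its end.
visit-list : ∀ {A : Set} (done : List A) {u} queue {vs} →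
             (done ++ [ u ]) ++ (queue ++ vs) ≡ (done ++ u ∷ queue) ++ vs
visit-list done {u} queue {vs} =
  trans (++-assoc done [ u ] (queue ++ vs)) (sym (++-assoc done (u ∷ queue) vs))

module _ (G : Graph n) where
  open Graph G

  open DecMembership (_≟_ {n}) using (_∈?_)

  Closed : List (Fin n) → Set
  Closed xs = ∀ {v w} → v ∈ xs → adjacent v w ≡ true → w ∈ xs

  HasNeighbourIn : Fin n → List (Fin n) → Set
  HasNeighbourIn v xs = ∃[ w ] w ∈ xs × adjacent w v ≡ true

  -- Visiting `u` appends its unlisted neighbours, and nothing is ever removed. With an empty queue
  -- this makes `done` closed under adjacency.
  processed-neighbours : ∀ {done queue} → CM G done queue →
    ∀ {v w} → v ∈ done → adjacent v w ≡ true → w ∈ done ++ queue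
  processed-neighbours (start _ cm _) v∈done v~w =
    ∈-++⁺ˡ (subst (_ ∈_) (++-identityʳ _) (processed-neighbours cm v∈done v~w))
  processed-neighbours (visit {done} {u} {queue} vs cm _ vs⇔ _) {v} {w} v∈ v~w =
    subst (w ∈_) (sym (visit-list done queue)) (listed (∈-++⁻ done v∈))
    where
    listed : v ∈ done ⊎ v ∈ [ u ] → w ∈ (done ++ u ∷ queue) ++ vs
    listed (inj₁ v∈done) = ∈-++⁺ˡ (processed-neighbours cm v∈done v~w)
    listed (inj₂ (here refl)) with w ∈? done ++ u ∷ queue
    ... | yes w∈ = ∈-++⁺ˡ w∈
    ... | no  w∉ = ∈-++⁺ʳ (done ++ u ∷ queue) (Equivalence.from (vs⇔ w) (v~w , w∉))

  -- The run is traced back to the step that appended `v`, with `xs` the nodes listed before it.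
  closed-or-neighbour : ∀ {done queue} → CM G done queue →
    ∀ xs {v ys} → done ++ queue ≡ xs ++ v ∷ ys → Closed xs ⊎ HasNeighbourIn v xs
  closed-or-neighbour empty [] ()
  closed-or-neighbour empty (_ ∷ _) ()
  closed-or-neighbour (start {done} _ cm _) xs eq with splitAt-++ done xs eq
  ... | inj₁ (_ , done≡) = closed-or-neighbour cm xs (trans (++-identityʳ done) done≡)
  -- Here `v` is the new starting node, so `xs` is the whole earlier list, all of it processed.
  ... | inj₂ ([] , refl , _) = inj₁ λ v∈ v~w →
    processed-neighbours cm (subst (_ ∈_) (++-identityʳ done) v∈) v~w
  ... | inj₂ (_ ∷ [] , _ , ())
  ... | inj₂ (_ ∷ _ ∷ _ , _ , ())
  closed-or-neighbour (visit {done} {u} {queue} vs cm _ vs⇔ _) xs eq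
    with splitAt-++ (done ++ u ∷ queue) xs (trans (sym (visit-list done queue)) eq)
  ... | inj₁ (_ , old≡) = closed-or-neighbour cm xs old≡
  -- Here `v` is among the nodes appended for `u`, and `u` was listed before all of them.
  ... | inj₂ (cs , refl , refl) =
    inj₂ (u , ∈-++⁺ˡ (∈-insert done) , proj₁ (Equivalence.to (vs⇔ _) (∈-insert cs)))

-- Lists with decreasing values

before⇒larger : ∀ {A : Set} (f : A → ℕ) xs {v ys} → AllPairs (λ a b → f b < f a) (xs ++ v ∷ ys) →
                ∀ {x} → x ∈ xs → f v < f x
before⇒larger f (x ∷ xs) (x> ∷ _)  (here refl) = All.lookup x> (∈-insert xs)
before⇒larger f (x ∷ xs) (_ ∷ des) (there x∈)  = before⇒larger f xs des x∈

larger⇒before : ∀ {A : Set} (f : A → ℕ) xs {v ys} → AllPairs (λ a b → f b < f a) (xs ++ v ∷ ys) →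
                ∀ {x} → x ∈ xs ++ v ∷ ys → f v < f x → x ∈ xs
larger⇒before f []       _         (here refl) v<x = contradiction v<x (ℕ.<-irrefl refl)
larger⇒before f []       (v> ∷ _)  (there x∈)  v<x = contradiction (All.lookup v> x∈) (ℕ.<-asym v<x)
larger⇒before f (_ ∷ xs) _         (here refl) v<x = here refl
larger⇒before f (_ ∷ xs) (_ ∷ des) (there x∈)  v<x = there (larger⇒before f xs des x∈ v<x)

opposite-anti-< : {i j : Fin n} → i Fin.< j → opposite j Fin.< opposite i
opposite-anti-< {n} {i} {j} i<j rewrite opposite-prop i | opposite-prop j =
  ℕ.∸-monoʳ-< (s≤s i<j) (toℕ<n j)

-- RCM numberings and the relabelled graph

module _ (G : Graph n) (π : Permutation′ n) where
  open Graph G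

  module _ {us : List (Fin n)} (numbering : map (π ⟨$⟩ʳ_) us ≡ tabulate opposite) where

    all-numbered : ∀ i → i ∈ map (π ⟨$⟩ʳ_) us
    all-numbered i = subst (i ∈_) (sym numbering)
      (subst (_∈ tabulate opposite) (opposite-involutive i) (∈-tabulate⁺ (opposite i)))

    all-listed : ∀ v → v ∈ us
    all-listed v with w , w∈us , πv≡πw ← ∈-map⁻ (π ⟨$⟩ʳ_) (all-numbered (π ⟨$⟩ʳ v)) =
      subst (_∈ us) (trans (sym (inverseˡ π)) (trans (cong (π ⟨$⟩ˡ_) (sym πv≡πw)) (inverseˡ π))) w∈us

    -- The list `tabulate opposite` runs from the largest index down to `zero`.
    descending : AllPairs (λ v w → π ⟨$⟩ʳ w Fin.< π ⟨$⟩ʳ v) us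
    descending = AllPairs.map⁻ (subst (AllPairs Fin._>_) (sym numbering)
      (AllPairs.tabulate⁺-< opposite-anti-<))

  -- The nodes numbered above `v` are exactly those listed before it. Either they are closed, or one
  -- of them is a neighbour of `v`, against `noHigher`.
  RCM-higher-closed : IsRCM G π → ∀ v → (∀ w → π ⟨$⟩ʳ v Fin.< π ⟨$⟩ʳ w → adjacent v w ≡ false) →
    ∀ {x y} → π ⟨$⟩ʳ v Fin.< π ⟨$⟩ʳ x → adjacent x y ≡ true → π ⟨$⟩ʳ v Fin.< π ⟨$⟩ʳ y
  RCM-higher-closed (us , cm , numbering) v noHigher {x} v<x x~y
    with all-listed numbering x | descending numbering | ∈-∃++ (all-listed numbering v)
  ... | x∈us | desc | xs , ys , refl with closed-or-neighbour G cm xs (++-identityʳ us)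
  ... | inj₁ closed =
    before⇒larger number xs desc (closed (larger⇒before number xs desc x∈us v<x) x~y)
    where number = toℕ ∘ (π ⟨$⟩ʳ_)
  ... | inj₂ (w , w∈xs , w~v) = contradiction
    (trans (sym w~v) (trans (symmetric w v) (noHigher w (before⇒larger number xs desc w∈xs)))) λ ()
    where number = toℕ ∘ (π ⟨$⟩ʳ_)

  relabel : Graph n
  relabel = record
    { adjacent  = λ i j → adjacent (π ⟨$⟩ˡ i) (π ⟨$⟩ˡ j)
    ; symmetric = λ i j → symmetric (π ⟨$⟩ˡ i) (π ⟨$⟩ˡ j)
    ; loopless  = λ i → loopless (π ⟨$⟩ˡ i)
    }

  -- The adjacency parts agree by definition; on the diagonal, a degree is a sum over all nodes,
  -- which renumbering merely permutes.
  reorderedLaplacian-relabel : ∀ i j → reorderedLaplacian G π i j ≡ laplacian relabel i j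
  reorderedLaplacian-relabel i j = trans (permute-from π (laplacian G) i j)
    (cong (ℤ._- adjacencyMatrix relabel i j) degreeMatrix-relabel)
    where
    degreeMatrix-relabel : degreeMatrix G (π ⟨$⟩ˡ i) (π ⟨$⟩ˡ j) ≡ degreeMatrix relabel i j
    degreeMatrix-relabel with i ≟ j
    ... | yes refl = trans (degreeMatrix-diagonal G _)
      (Σ.sum-permute (adjacencyMatrix G (π ⟨$⟩ˡ i)) (flip π))
    ... | no i≢j = degreeMatrix-offDiagonal G λ eq →
      i≢j (trans (sym (inverseʳ π)) (trans (cong (π ⟨$⟩ʳ_) eq) (inverseʳ π)))

theorem4p3 : (n : ℕ) → 2 ≤ n → (G : Graph n) (π : Permutation′ n) → IsRCM G π →
    let L̂ = reorderedLaplacian G π in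
    Irreducible L̂ ⇔ ((i : Fin n) → rowSumToDiagonal L̂ i ≡ 0ℤ → suc (toℕ i) ≡ n)
theorem4p3 n 2≤n G π rcm = mk⇔
  -- By contradiction: a zero sum in a row other than the last would make the matrix reducible.
  (λ irreducible i s≡0 → decidable-stable (suc (toℕ i) ℕ.≟ n) λ i≢last →
    irreducible (Reducible-resp (λ j k → sym (L̂≗ j k)) (laplacian-block H i i≢last
      (higher-closed i (Equivalence.to (zero⇔ i) s≡0)))))
  (λ onlyLast reducible → laplacian-reducible H 2≤n (Reducible-resp L̂≗ reducible)
    λ i none → onlyLast i (Equivalence.from (zero⇔ i) none))
  where
  H = relabel G π
  L̂≗ = reorderedLaplacian-relabel G π

  zero⇔ : ∀ i → rowSumToDiagonal (reorderedLaplacian G π) i ≡ 0ℤ ⇔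
                (∀ j → i Fin.< j → Graph.adjacent H i j ≡ false)
  zero⇔ i = mk⇔
    (λ s≡0 → Equivalence.to (rowSumToDiagonal-zero⇔ H i) (trans (sym rowSum≡) s≡0))
    (λ none → trans rowSum≡ (Equivalence.from (rowSumToDiagonal-zero⇔ H i) none))
    where
    rowSum≡ : rowSumToDiagonal (reorderedLaplacian G π) i ≡ rowSumToDiagonal (laplacian H) i
    rowSum≡ = Σ.sum-cong-≗ λ j → L̂≗ i (inject≤ j (toℕ<n i))

  higher-closed : ∀ i → (∀ j → i Fin.< j → Graph.adjacent H i j ≡ false) →
    ∀ {j k} → i Fin.< j → Graph.adjacent H j k ≡ true → i Fin.< k
  higher-closed i none i<j j~k =
    -- The new number `i` belongs to the original node `π ⟨$⟩ˡ i`; the rest translates between the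
    -- two namings.
    subst₂ Fin._<_ (inverseʳ π) (inverseʳ π)
      (RCM-higher-closed G π rcm (π ⟨$⟩ˡ i)
        (λ w πi<w → subst (λ u → Graph.adjacent G (π ⟨$⟩ˡ i) u ≡ false) (inverseˡ π)
          (none (π ⟨$⟩ʳ w) (subst (Fin._< π ⟨$⟩ʳ w) (inverseʳ π) πi<w)))
        (subst₂ Fin._<_ (sym (inverseʳ π)) (sym (inverseʳ π)) i<j) j~k)
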